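{- The conditional operation is not smooth in the variety of conditional algebras: there exist a conditional algebra $\langle A,\to\rangle$ and sets $U,V\subseteq\mathrm{Ul}(A)$ such that $U\to^{\sigma}V\neq U\to^{\pi}V$.
   Context: A conditional algebra is a pair $\langle A,\to\rangle$ where $A$ is a Boolean algebra and $\to$ is a binary operation on $A$ such that for all $a,b,c$: $a\to 1=1$; $(a\to b)\wedge(a\to c)=a\to(b\wedge c)$; $(a\vee b)\to c\le (a\to c)\wedge(b\to c)$. $\mathrm{Ul}(A)$ carries the Stone topology with basic clopens $\varphi(a)=\{u:a\in u\}$. For $U,V\subseteq\mathrm{Ul}(A)$: the $\pi$-extension is $U\to^{\pi}V=\bigcap_{(Y,O)}\bigcup\{\varphi(a\to b): Y\subseteq\varphi(a),\ \varphi(b)\subseteq O\}$ over closed $Y\subseteq U$ and open $O\supseteq V$; the $\sigma$-extension is $U\to^{\sigma}V=\bigcup_{(O,Y)}\bigcap\{\varphi(a\to b): \varphi(a)\subseteq O,\ Y\subseteq\varphi(b)\}$ over open $O\supseteq U$ and closed $Y\subseteq V$. The operation is smooth if these always coincide. -}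

module Defs where

open import Algebra.Core using (Op₂)
open import Algebra.Definitions using (Congruent₂)
open import Algebra.Lattice.Bundles using (BooleanAlgebra)
import Algebra.Lattice.Properties.Lattice as LatticeProperties
open import Data.Product.Base using (∃; ∃₂; _×_)
open import Data.Sum.Base using (_⊎_)
open import Level using (Level; _⊔_; suc)
open import Relation.Binary.Bundles using (Poset)
open import Relation.Binary.Core using (Rel)
open import Relation.Binary.Definitions using (_Respects_)
open import Relation.Unary using (Pred; _∈_; _∉_; _⊆_; _≐_; ∁)

record ConditionalAlgebra (c ℓ : Level) : Set (suc (c ⊔ ℓ)) where
  infixr 5 _⇒_
  field
    booleanAlgebra : BooleanAlgebra c ℓ

  open BooleanAlgebra booleanAlgebra public

  open Poset (LatticeProperties.poset lattice) public using (_≤_)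

  field
    _⇒_    : Op₂ Carrier
    ⇒-cong : Congruent₂ _≈_ _⇒_
    ⇒-⊤    : ∀ a → a ⇒ ⊤ ≈ ⊤
    ⇒-∧    : ∀ a b c → (a ⇒ b) ∧ (a ⇒ c) ≈ a ⇒ (b ∧ c)
    ∨-⇒    : ∀ a b c → (a ∨ b) ⇒ c ≤ (a ⇒ c) ∧ (b ⇒ c)

module Extensions {c ℓ : Level} (𝔸 : ConditionalAlgebra c ℓ) where
  open ConditionalAlgebra 𝔸

  record Ul : Set (suc (c ⊔ ℓ)) where
    field
      member : Pred Carrier (c ⊔ ℓ)
      upward : ∀ {a b} → a ≤ b → a ∈ member → b ∈ member
      has-⊤  : ⊤ ∈ member
      has-∧  : ∀ {a b} → a ∈ member → b ∈ member → a ∧ b ∈ member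
      proper : ⊥ ∉ member
      ultra  : ∀ a → a ∈ member ⊎ ¬ a ∈ member

  open Ul public using (member)

  -- Equality of ultrafilters as subsets of A.
  _≋_ : Rel Ul (c ⊔ ℓ)
  u ≋ v = member u ≐ member v

  -- A subset of Ul(A) is a predicate that respects ≋.  Open and closed
  -- predicates, as defined below, do so automatically.
  Extensional : ∀ {p} → Pred Ul p → Set (suc (c ⊔ ℓ) ⊔ p)
  Extensional U = U Respects _≋_

  φ : Carrier → Pred Ul (c ⊔ ℓ)
  φ a u = a ∈ member u

  -- The Stone topology, generated by the base { φ a ∣ a ∈ A }.
  IsOpen : Pred Ul (c ⊔ ℓ) → Set (suc (c ⊔ ℓ))
  IsOpen O = ∀ {u} → u ∈ O → ∃ λ a → u ∈ φ a × φ a ⊆ O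

  IsClosed : Pred Ul (c ⊔ ℓ) → Set (suc (c ⊔ ℓ))
  IsClosed Y = ∃ λ O → IsOpen O × Y ≐ ∁ O

  -- ⋂ over closed Y ⊆ U and open O ⊇ V of
  -- ⋃ { φ (a ⇒ b) ∣ Y ⊆ φ a , φ b ⊆ O }.
  _⇒π_ : Pred Ul (c ⊔ ℓ) → Pred Ul (c ⊔ ℓ) → Pred Ul (suc (c ⊔ ℓ))
  (U ⇒π V) u =
    ∀ Y O → IsClosed Y → Y ⊆ U → IsOpen O → V ⊆ O →
    ∃₂ λ a b → Y ⊆ φ a × φ b ⊆ O × u ∈ φ (a ⇒ b)

  -- ⋃ over open O ⊇ U and closed Y ⊆ V of
  -- ⋂ { φ (a ⇒ b) ∣ φ a ⊆ O , Y ⊆ φ b }.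
  _⇒σ_ : Pred Ul (c ⊔ ℓ) → Pred Ul (c ⊔ ℓ) → Pred Ul (suc (c ⊔ ℓ))
  (U ⇒σ V) u =
    ∃₂ λ O Y → IsOpen O × U ⊆ O × IsClosed Y × Y ⊆ V ×
    (∀ a b → φ a ⊆ O → Y ⊆ φ b → u ∈ φ (a ⇒ b))

{-# OPTIONS --safe #-}

-- Let A be the algebra of finite and cofinite subsets of ℕ and let U = V be the
-- open set of ultrafilters containing a finite set.  If, at a point u,
-- a ⇒ b ∈ u holds exactly when a ≤ b, then u ∈ U ⇒π V says that every finite a
-- lies below some finite b, whereas u ∈ U ⇒σ V says that one finite b lies
-- above every finite a.
--
-- Proving u ∈ U ⇒π V directly uses that a closed subset of U is contained in φ a
-- for some finite a; this compactness is not available constructively.  So ⇒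
-- is given a different behaviour at the point 0, where a ⇒ b holds exactly when
-- a is finite or b is ⊤.  The point 0 evidently lies in U ⇒σ V, and its
-- membership in U ⇒π V is the required compactness, so that the inclusion
-- σ ⊆ π, at 0, refutes the inclusion π ⊆ σ, at 1.

module Submission where

open import Defs
open import Algebra.Lattice.Bundles using (BooleanAlgebra)
open import Algebra.Lattice.Structures using (IsDistributiveLattice; IsLattice)
import Algebra.Lattice.Properties.Lattice as LatticeProperties
open import Data.Bool.Base as Bool using (Bool; true; false)
import Data.Bool.Properties as Bool
open import Data.Empty using (⊥)
open import Data.Nat.Base as ℕ using (ℕ; zero; suc)
import Data.Nat.Properties as ℕ
open import Data.Product.Base using (Σ-syntax; ∃; _×_; _,_; proj₁; proj₂)
open import Data.Sum.Base using (_⊎_; inj₁; inj₂)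
open import Data.Unit.Base using (⊤; tt)
open import Function.Base using (id; _∘_)
open import Function.Bundles using (mk⇔)
open import Level using (0ℓ)
open import Relation.Binary.Definitions using (Decidable)
import Relation.Binary.Lattice.Bundles as Order
open import Relation.Binary.PropositionalEquality
open import Relation.Nullary.Decidable using (Dec; yes; no; does; map′; _×-dec_; _⊎-dec_; does-⇔; dec-true; dec-false)
open import Relation.Nullary.Negation.Core using (¬_; contradiction)
open import Relation.Unary using (Pred; _≐_; _⊆_)

-- The Boolean algebra of finite and cofinite subsets of ℕ

record EventuallyConstant : Set where
  field
    at         : ℕ → Bool
    limit      : Bool
    bound      : ℕ
    eventually : ∀ {n} → bound ℕ.≤ n → at n ≡ limit

open EventuallyConstant

infix 4 _≈_ _≈?_

-- Only the values count; `limit-cong` shows that they determine `limit`, so finiteness respects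
-- `_≈_`.
_≈_ : EventuallyConstant → EventuallyConstant → Set
a ≈ b = ∀ n → at a n ≡ at b n

const : Bool → EventuallyConstant
const x = record { at = λ _ → x ; limit = x ; bound = 0 ; eventually = λ _ → refl }

map : (Bool → Bool) → EventuallyConstant → EventuallyConstant
map f a = record
  { at         = f ∘ at a
  ; limit      = f (limit a)
  ; bound      = bound a
  ; eventually = cong f ∘ eventually a
  }

zipWith : (Bool → Bool → Bool) → EventuallyConstant → EventuallyConstant → EventuallyConstant
zipWith f a b = record
  { at         = λ n → f (at a n) (at b n)
  ; limit      = f (limit a) (limit b)
  ; bound      = bound a ℕ.⊔ bound b
  ; eventually = λ le → cong₂ f (eventually a (ℕ.m⊔n≤o⇒m≤o (bound a) (bound b) le))
                                (eventually b (ℕ.m⊔n≤o⇒n≤o (bound a) (bound b) le))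
  }

segment : ℕ → EventuallyConstant
segment k = record
  { at         = λ n → does (n ℕ.≤? k)
  ; limit      = false
  ; bound      = suc k
  ; eventually = λ {n} k<n → dec-false (n ℕ.≤? k) (ℕ.<⇒≱ k<n)
  }

limit-local : ∀ a b {n} → bound a ℕ.⊔ bound b ℕ.≤ n → at a n ≡ at b n → limit a ≡ limit b
limit-local a b le eq = trans (sym (eventually a (ℕ.m⊔n≤o⇒m≤o (bound a) (bound b) le)))
  (trans eq (eventually b (ℕ.m⊔n≤o⇒n≤o (bound a) (bound b) le)))

limit-cong : ∀ a b → a ≈ b → limit a ≡ limit b
limit-cong a b a≈b = limit-local a b ℕ.≤-refl (a≈b _)

_≈?_ : Decidable _≈_
-- Testing below `suc m` includes `m` itself, where both values are already the limits; agreement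
-- there gives agreement everywhere beyond.
a ≈? b = map′ extend (λ a≈b _ → a≈b _) (ℕ.allUpTo? (λ n → at a n Bool.≟ at b n) (suc m))
  where
  m : ℕ
  m = bound a ℕ.⊔ bound b

  extend : (∀ {n} → n ℕ.< suc m → at a n ≡ at b n) → a ≈ b
  extend eq n with n ℕ.≤? m
  ... | yes n≤m = eq (ℕ.s≤s n≤m)
  ... | no  n≰m = trans (eventually a (ℕ.m⊔n≤o⇒m≤o (bound a) (bound b) m≤n))
    (trans (limit-local a b ℕ.≤-refl (eq ℕ.≤-refl))
           (sym (eventually b (ℕ.m⊔n≤o⇒n≤o (bound a) (bound b) m≤n))))
    where
    m≤n : m ℕ.≤ n
    m≤n = ℕ.<⇒≤ (ℕ.≰⇒> n≰m)

isLattice : IsLattice _≈_ (zipWith Bool._∨_) (zipWith Bool._∧_)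
isLattice = record
  { isEquivalence = record
    { refl  = λ _ → refl
    ; sym   = λ p n → sym (p n)
    ; trans = λ p q n → trans (p n) (q n)
    }
  ; ∨-comm     = λ a b n → Bool.∨-comm (at a n) (at b n)
  ; ∨-assoc    = λ a b c n → Bool.∨-assoc (at a n) (at b n) (at c n)
  ; ∨-cong     = λ p q n → cong₂ Bool._∨_ (p n) (q n)
  ; ∧-comm     = λ a b n → Bool.∧-comm (at a n) (at b n)
  ; ∧-assoc    = λ a b c n → Bool.∧-assoc (at a n) (at b n) (at c n)
  ; ∧-cong     = λ p q n → cong₂ Bool._∧_ (p n) (q n)
  ; absorptive = (λ a b n → Bool.∨-abs-∧ (at a n) (at b n))
               , (λ a b n → Bool.∧-abs-∨ (at a n) (at b n))
  }

isDistributiveLattice : IsDistributiveLattice _≈_ (zipWith Bool._∨_) (zipWith Bool._∧_)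
isDistributiveLattice = record
  { isLattice   = isLattice
  ; ∨-distrib-∧ = (λ a b c n → Bool.∨-distribˡ-∧ (at a n) (at b n) (at c n))
                , (λ a b c n → Bool.∨-distribʳ-∧ (at a n) (at b n) (at c n))
  ; ∧-distrib-∨ = (λ a b c n → Bool.∧-distribˡ-∨ (at a n) (at b n) (at c n))
                , (λ a b c n → Bool.∧-distribʳ-∨ (at a n) (at b n) (at c n))
  }

booleanAlgebra : BooleanAlgebra 0ℓ 0ℓ
booleanAlgebra = record
  { Carrier = EventuallyConstant
  ; _≈_     = _≈_
  ; _∨_     = zipWith Bool._∨_
  ; _∧_     = zipWith Bool._∧_
  ; ¬_      = map Bool.not
  ; ⊤       = const true
  ; ⊥       = const false
  ; isBooleanAlgebra = record
    { isDistributiveLattice = isDistributiveLattice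
    ; ∨-complement = (λ a n → Bool.∨-inverseˡ (at a n)) , (λ a n → Bool.∨-inverseʳ (at a n))
    ; ∧-complement = (λ a n → Bool.∧-inverseˡ (at a n)) , (λ a n → Bool.∧-inverseʳ (at a n))
    ; ¬-cong       = λ p n → cong Bool.not (p n)
    }
  }

open BooleanAlgebra booleanAlgebra using (_∨_; _∧_)

module ≤ = Order.Lattice
  (LatticeProperties.∨-∧-orderTheoreticLattice (BooleanAlgebra.lattice booleanAlgebra))
open ≤ using (_≤_)

-- The conditional operation

Finite : Pred EventuallyConstant 0ℓ
Finite a = limit a ≡ false

finite-down : ∀ a b → a ≤ b → Finite b → Finite a
finite-down a b a≤b fin = trans (limit-cong a (a ∧ b) a≤b)
  (trans (cong (limit a Bool.∧_) fin) (Bool.∧-zeroʳ (limit a)))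

≤-⊤ : ∀ a → a ≤ const true
≤-⊤ a n = sym (Bool.∧-identityʳ (at a n))

Conditional : ℕ → EventuallyConstant → EventuallyConstant → Set
Conditional zero    a b = Finite a ⊎ const true ≤ b
Conditional (suc _) a b = a ≤ b

conditional? : ∀ n a b → Dec (Conditional n a b)
conditional? zero    a b = (limit a Bool.≟ false) ⊎-dec (const true ≈? const true ∧ b)
conditional? (suc _) a b = a ≈? a ∧ b

conditional-⊤ : ∀ n a → Conditional n a (const true)
conditional-⊤ zero    a = inj₂ (≤-⊤ (const true))
conditional-⊤ (suc _) a = ≤-⊤ a

-- Supplies `⇒-cong`, `∨-⇒` and one direction of `⇒-∧`.
conditional-mono : ∀ n {a a′ b b′} → a′ ≤ a → b ≤ b′ → Conditional n a b → Conditional n a′ b′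
conditional-mono zero {a} {a′} p _ (inj₁ fin) = inj₁ (finite-down a′ a p fin)
conditional-mono zero {b = b} {b′} _ q (inj₂ ⊤≤b) = inj₂ (≤.trans {const true} {b} {b′} ⊤≤b q)
conditional-mono (suc _) {a} {a′} {b} {b′} p q a≤b =
  ≤.trans {a′} {a} {b′} p (≤.trans {a} {b} {b′} a≤b q)

conditional-∧ : ∀ n a b c → Conditional n a b → Conditional n a c → Conditional n a (b ∧ c)
conditional-∧ zero    a b c (inj₁ fin) _          = inj₁ fin
conditional-∧ zero    a b c (inj₂ _)   (inj₁ fin) = inj₁ fin
conditional-∧ zero    a b c (inj₂ p)   (inj₂ q)   = inj₂ (≤.∧-greatest {const true} {b} {c} p q)
conditional-∧ (suc _) a b c p          q          = ≤.∧-greatest {a} {b} {c} p q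

_⇒_ : EventuallyConstant → EventuallyConstant → EventuallyConstant
a ⇒ b = record
  { at         = λ n → does (conditional? n a b)
  -- All successors carry the same relation, so the value at 1 is the limit and 0 is the only
  -- exceptional point.
  ; limit      = does (conditional? 1 a b)
  ; bound      = 1
  ; eventually = λ { (ℕ.s≤s _) → refl }
  }

conditionalAlgebra : ConditionalAlgebra 0ℓ 0ℓ
conditionalAlgebra = record
  { booleanAlgebra = booleanAlgebra
  ; _⇒_    = _⇒_
  ; ⇒-cong = λ {a} {a′} {b} {b′} p q n → does-⇔
      (mk⇔ (conditional-mono n {a} {a′} {b} {b′}
              (≤.reflexive {a′} {a} (sym ∘ p)) (≤.reflexive {b} {b′} q))
           (conditional-mono n {a′} {a} {b′} {b}
              (≤.reflexive {a} {a′} p) (≤.reflexive {b′} {b} (sym ∘ q))))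
      (conditional? n a b) (conditional? n a′ b′)
  ; ⇒-⊤    = λ a n → dec-true (conditional? n a (const true)) (conditional-⊤ n a)
  ; ⇒-∧    = λ a b c n → does-⇔
      (mk⇔ (λ (p , q) → conditional-∧ n a b c p q)
           (λ p → conditional-mono n {a} {a} {b ∧ c} {b} (≤.refl {a}) (≤.x∧y≤x b c) p
                , conditional-mono n {a} {a} {b ∧ c} {c} (≤.refl {a}) (≤.x∧y≤y b c) p))
      (conditional? n a b ×-dec conditional? n a c) (conditional? n a (b ∧ c))
  -- Here `x ≤ y` unfolds to `x ≈ x ∧ y`, so the inequality becomes an equivalence with a product.
  ; ∨-⇒    = λ a b c n → does-⇔
      (mk⇔ (λ p → p
                , conditional-mono n {a ∨ b} {a} {c} {c} (≤.x≤x∨y a b) (≤.refl {c}) p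
                , conditional-mono n {a ∨ b} {b} {c} {c} (≤.y≤x∨y a b) (≤.refl {c}) p)
           proj₁)
      (conditional? n (a ∨ b) c)
      (conditional? n (a ∨ b) c ×-dec (conditional? n a c ×-dec conditional? n b c))
  }

-- Ultrafilters and the failure of smoothness

module NotSmooth where
  open Extensions conditionalAlgebra

  true-or-not : ∀ x → x ≡ true ⊎ Bool.not x ≡ true
  true-or-not true  = inj₁ refl
  true-or-not false = inj₂ refl

  principal : ℕ → Ul
  principal n = record
    { member = λ a → at a n ≡ true
    ; upward = λ {a} {b} a≤b a∈ → trans (cong (Bool._∧ at b n) (sym a∈)) (trans (sym (a≤b n)) a∈)
    ; has-⊤  = refl
    ; has-∧  = cong₂ Bool._∧_
    ; proper = λ ()
    ; ultra  = λ a → true-or-not (at a n)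
    }

  cofinite : Ul
  cofinite = record
    { member = λ a → limit a ≡ true
    ; upward = λ {a} {b} a≤b a∈ → trans (cong (Bool._∧ limit b) (sym a∈))
                                        (trans (sym (limit-cong a (a ∧ b) a≤b)) a∈)
    ; has-⊤  = refl
    ; has-∧  = cong₂ Bool._∧_
    ; proper = λ ()
    ; ultra  = λ a → true-or-not (limit a)
    }

  U : Pred Ul 0ℓ
  U u = ∃ λ a → Finite a × member u a

  U-extensional : Extensional U
  U-extensional (⊆ , _) (a , fin , a∈u) = a , fin , ⊆ a∈u

  U-open : IsOpen U
  U-open (a , fin , a∈u) = a , a∈u , λ a∈v → a , fin , a∈v

  -- If `a` had limit `true`, it would belong to `cofinite`, an ultrafilter outside `U` because it
  -- contains no finite set.
  φ⊆U⇒finite : ∀ a → φ a ⊆ U → Finite a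
  φ⊆U⇒finite a φa⊆U with limit a in eq
  ... | false = refl
  ... | true with φa⊆U {cofinite} eq
  ...   | b , fin , b∈ with () ← trans (sym fin) b∈

  ∅-closed : IsClosed (λ _ → ⊥)
  ∅-closed = (λ _ → ⊤) , (λ {u} _ → const true , Ul.has-⊤ u , λ _ → tt) , (λ ()) , λ ∉ → ∉ tt

  conditional⇒member : ∀ n a b → Conditional n a b → φ (a ⇒ b) (principal n)
  conditional⇒member n a b = dec-true (conditional? n a b)

  member⇒conditional : ∀ n a b → φ (a ⇒ b) (principal n) → Conditional n a b
  member⇒conditional n a b ∈ with conditional? n a b
  ... | yes p = p
  ... | no _  with () ← ∈

  0∈σ : (U ⇒σ U) (principal 0)
  -- The empty closed set puts no constraint on `b`; the open set `U` forces `a` to be finite, which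
  -- suffices at 0.
  0∈σ = U , (λ _ → ⊥) , (λ {u} → U-open {u}) , id , ∅-closed , (λ ()) ,
    λ a b φa⊆U _ → conditional⇒member 0 a b (inj₁ (φ⊆U⇒finite a (λ {u} → φa⊆U {u})))

  ClosedBelowFinite : Set₁
  ClosedBelowFinite = ∀ Y → IsClosed Y → Y ⊆ U → ∃ λ a → Finite a × Y ⊆ φ a

  -- Choosing `U` as the open set makes `b` finite, which excludes `⊤ ≤ b`; what remains is that `a`
  -- is finite.
  0∈π⇒compact : (U ⇒π U) (principal 0) → ClosedBelowFinite
  0∈π⇒compact 0∈π Y closed Y⊆U with 0∈π Y U closed Y⊆U (λ {u} → U-open {u}) id
  ... | a , b , Y⊆φa , φb⊆U , ∈ with member⇒conditional 0 a b ∈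
  ...   | inj₁ fin = a , fin , Y⊆φa
  ...   | inj₂ ⊤≤b
          with () ← finite-down (const true) b ⊤≤b (φ⊆U⇒finite b (λ {u} → φb⊆U {u}))

  compact⇒1∈π : ClosedBelowFinite → (U ⇒π U) (principal 1)
  compact⇒1∈π compact Y O closed Y⊆U _ U⊆O with compact Y closed Y⊆U
  -- The finite bound of `Y` serves as antecedent and consequent at once, since `φ a ⊆ U ⊆ O` and
  -- `a ≤ a`.
  ... | a , fin , Y⊆φa = a , a , Y⊆φa , (λ a∈u → U⊆O (a , fin , a∈u)) ,
    conditional⇒member 1 a a (≤.refl {a})

  -- The segment up to `bound c` contains `bound c`, where `c` is already `false`.
  no-greatest-finite : ∀ c → Finite c → ¬ (∀ a → Finite a → a ≤ c)
  no-greatest-finite c fin greatest = contradiction true≡false λ ()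
    where
    k : ℕ
    k = bound c

    open ≡-Reasoning

    true≡false : true ≡ false
    true≡false = begin
      true                             ≡⟨ dec-true (k ℕ.≤? k) ℕ.≤-refl ⟨
      at (segment k) k                 ≡⟨ greatest (segment k) refl k ⟩
      at (segment k) k Bool.∧ at c k   ≡⟨ cong (at (segment k) k Bool.∧_) (eventually c ℕ.≤-refl) ⟩
      at (segment k) k Bool.∧ limit c  ≡⟨ cong (at (segment k) k Bool.∧_) fin ⟩
      at (segment k) k Bool.∧ false    ≡⟨ Bool.∧-zeroʳ _ ⟩
      false                            ∎

  -- A finite `c` bounding `Y` is an admissible consequent for every finite `a`, so at 1 it would
  -- lie above all of them.
  compact⇒1∉σ : ClosedBelowFinite → ¬ (U ⇒σ U) (principal 1)
  compact⇒1∉σ compact (O , Y , _ , U⊆O , closed , Y⊆U , ∈) with compact Y closed Y⊆U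
  ... | c , fin , Y⊆φc = no-greatest-finite c fin λ a fin-a → member⇒conditional 1 a c
    (∈ a c (λ a∈u → U⊆O (a , fin-a , a∈u)) Y⊆φc)

theorem2p17 : Σ[ 𝔸 ∈ ConditionalAlgebra 0ℓ 0ℓ ] (let open Extensions 𝔸 in
    Σ[ U ∈ Pred Ul 0ℓ ] Σ[ V ∈ Pred Ul 0ℓ ]
    Extensional U × Extensional V × ¬ ((U ⇒σ V) ≐ (U ⇒π V)))
theorem2p17 = conditionalAlgebra , U , U ,
  (λ {u} {v} → U-extensional {u} {v}) , (λ {u} {v} → U-extensional {u} {v}) ,
  λ (σ⊆π , π⊆σ) → let compact = 0∈π⇒compact (σ⊆π {principal 0} 0∈σ) in
    compact⇒1∉σ compact (π⊆σ {principal 1} (compact⇒1∈π compact))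
  where open NotSmooth
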